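{- Let $G$ be a graph with vertex set $[n]$, let $\pi\in\mathrm{Ham}(G)$ be a Hamiltonian path of $G$, and let $p=(p_1,\dots,p_n)\in[n]^n$ be a parking preference. Then $p\in\mathrm{FPF}(G)$ with $\mathcal{O}_G(p)=\pi$ if and only if for every $i\in[n]$ we have $p_i\in S_i$, where $S_i:=\{s\in[n] : \pi_s\in B(i,\pi,G)\}$ is the set of positions in $\pi$ occupied by elements of the blocking sequence $B(i,\pi,G)$.
   Context: $[n]=\{1,\dots,n\}$, $S_n$ is the set of permutations of $[n]$ in one-line notation $\pi=\pi_1\cdots\pi_n$. Friendship parking process for a graph $G$ on $[n]$ and a parking preference $p\in[n]^n$: cars $1,\dots,n$ enter in order into spots $1,\dots,n$ (initially empty); spot $k$ is available for car $i$ if it is unoccupied when $i$ enters and each of spots $k-1,k+1$ is unoccupied or occupied by a car adjacent to $i$ in $G$ (spots $0,n+1$ count as unoccupied); car $i$ parks in the first available spot $k\ge p_i$, failing otherwise. $\mathrm{FPF}(G)$ is the set of $p$ for which all cars park; for such $p$, $\mathcal{O}_G(p)=\pi\in S_n$ where $\pi_k$ is the car in spot $k$ at the end. $\mathrm{Ham}(G)$ is the set of permutations $\pi\in S_n$ with $\{\pi_k,\pi_{k+1}\}$ an edge of $G$ for all $k\in[n-1]$. Blockers: for $\pi\in\mathrm{Ham}(G)$ and $i\in[n]$, an element $j=\pi_k$ is a blocker for $i$ in $\pi$ if either (1) $j\le i$, or (2) $j>i$ and there is $\ell\in\{\pi_{k-1},\pi_{k+1}\}$ (a neighbour of $j$ in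 the sequence $\pi$) with $\ell<i$ and $\ell$ not adjacent to $i$ in $G$. The blocking sequence $B(i,\pi,G)$ is the longest contiguous block $\pi_s\pi_{s+1}\cdots\pi_{t}$ of $\pi$ ending at $\pi_t=i$ all of whose elements are blockers for $i$; $b(i,\pi,G)$ denotes its length. -}

module Defs where

open import Level using (0ℓ)
open import Data.Nat.Base as ℕ using (ℕ; zero; suc; _∸_)
import Data.Nat.Properties as ℕ
open import Data.Fin.Base using (Fin; toℕ; fromℕ<; _≤_; _<_)
open import Data.Fin.Properties using (_≟_; _≤?_; all?)
open import Data.Fin.Permutation using (Permutation′; _⟨$⟩ʳ_; _⟨$⟩ˡ_)
open import Data.List.Base using (allFin; find)
open import Data.Maybe using (Maybe; just; nothing; map; _>>=_; Is-just; to-witness)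
open import Data.Maybe.Properties using (≡-dec)
open import Data.Maybe.Relation.Unary.All as Maybe using (All)
open import Data.Product.Base using (_×_; ∃-syntax; Σ-syntax)
open import Data.Sum.Base using (_⊎_)
open import Data.Vec.Functional using (Vector; replicate; updateAt)
open import Function.Base using (const; _∘_)
open import Relation.Binary.Core using (Rel)
open import Relation.Binary.Definitions using (Decidable; Symmetric; Irreflexive)
open import Relation.Binary.PropositionalEquality using (_≡_; _≗_)
open import Relation.Nullary using (¬_; Dec; _×-dec_; _⊎-dec_; _→-dec_)
open import Relation.Unary using (Pred; _∈_)

-- The set [n] is represented by Fin n, so cars, spots and vertices are
-- numbered 0, …, n - 1 rather than 1, …, n.

record Graph (n : ℕ) : Set₁ where
  field
    Adj    : Rel (Fin n) 0ℓ
    adj?   : Decidable Adj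
    sym    : Symmetric Adj
    irrefl : Irreflexive _≡_ Adj

open Graph public using (Adj; adj?)

-- Neighbouring k l says l ∈ {k - 1, k + 1}.  The spots next to the ends of the
-- street do not exist in Fin n, so they impose no condition below.

Neighbouring : ∀ {n} → Rel (Fin n) 0ℓ
Neighbouring k l = toℕ k ≡ suc (toℕ l) ⊎ toℕ l ≡ suc (toℕ k)

neighbouring? : ∀ {n} → Decidable (Neighbouring {n})
neighbouring? k l = (toℕ k ℕ.≟ suc (toℕ l)) ⊎-dec (toℕ l ℕ.≟ suc (toℕ k))

-- A configuration of the street gives, for each spot, the car in it (if any).

Street : ℕ → Set
Street n = Vector (Maybe (Fin n)) n

Preference : ℕ → Set
Preference n = Vector (Fin n) n

module _ {n : ℕ} (G : Graph n) where

  Available : Street n → Fin n → Pred (Fin n) 0ℓ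
  Available σ i k =
    σ k ≡ nothing × (∀ l → Neighbouring k l → All (Adj G i) (σ l))

  available? : ∀ σ i k → Dec (Available σ i k)
  available? σ i k =
    ≡-dec _≟_ (σ k) nothing
      ×-dec all? (λ l → neighbouring? k l →-dec Maybe.dec (adj? G i) (σ l))

  -- allFin n is increasing, so find returns the first suitable spot.

  firstAvailable : Street n → (i start : Fin n) → Maybe (Fin n)
  firstAvailable σ i start =
    find (λ k → (start ≤? k) ×-dec available? σ i k) (allFin n)

  park : Preference n → Fin n → Street n → Maybe (Street n)
  park p i σ =
    map (λ k → updateAt σ k (const (just i))) (firstAvailable σ i (p i))

  -- The street after the first m cars have entered, or nothing if one of them
  -- failed to park.

  parkFirst : Preference n → (m : ℕ) → m ℕ.≤ n → Maybe (Street n)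
  parkFirst p zero    _   = just (replicate n nothing)
  parkFirst p (suc m) m<n = parkFirst p m (ℕ.<⇒≤ m<n) >>= park p (fromℕ< m<n)

  FPF : Pred (Preference n) 0ℓ
  FPF p = Is-just (parkFirst p n ℕ.≤-refl)

  finalStreet : ∀ p → p ∈ FPF → Street n
  finalStreet p p∈FPF = to-witness p∈FPF

  -- Permutations are in one-line notation: π ⟨$⟩ʳ k is the entry π_k, and
  -- π ⟨$⟩ˡ j is the position of j.  The outcome of p ∈ FPF is π when the car in
  -- spot k of the final street is π_k, for every k.

  HasOutcome : Preference n → Permutation′ n → Set
  HasOutcome p π = Σ[ p∈FPF ∈ p ∈ FPF ] finalStreet p p∈FPF ≗ just ∘ (π ⟨$⟩ʳ_)

  Ham : Pred (Permutation′ n) 0ℓ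
  Ham π = ∀ k l → toℕ l ≡ suc (toℕ k) → Adj G (π ⟨$⟩ʳ k) (π ⟨$⟩ʳ l)

  Blocker : Fin n → Permutation′ n → Pred (Fin n) 0ℓ
  Blocker i π j =
    j ≤ i ⊎
    (i < j × ∃[ ℓ ] Neighbouring (π ⟨$⟩ˡ j) (π ⟨$⟩ˡ ℓ) × ℓ < i × ¬ Adj G ℓ i)

  -- The contiguous block π_s ⋯ π_t with π_t = i consists of blockers for i.

  BlockFrom : Fin n → Permutation′ n → Pred (Fin n) 0ℓ
  BlockFrom i π s =
    s ≤ π ⟨$⟩ˡ i ×
    (∀ r → s ≤ r → r ≤ π ⟨$⟩ˡ i → Blocker i π (π ⟨$⟩ʳ r))

  blockLength : Fin n → Permutation′ n → Fin n → ℕ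
  blockLength i π s = suc (toℕ (π ⟨$⟩ˡ i) ∸ toℕ s)

  LongestBlockFrom : Fin n → Permutation′ n → Pred (Fin n) 0ℓ
  LongestBlockFrom i π s =
    BlockFrom i π s ×
    (∀ s′ → BlockFrom i π s′ → blockLength i π s′ ℕ.≤ blockLength i π s)

  -- The set of entries of the blocking sequence.

  B : Fin n → Permutation′ n → Pred (Fin n) 0ℓ
  B i π j = ∃[ s ] LongestBlockFrom i π s × s ≤ π ⟨$⟩ˡ j × π ⟨$⟩ˡ j ≤ π ⟨$⟩ˡ i

  S : Fin n → Permutation′ n → Pred (Fin n) 0ℓ
  S i π s = π ⟨$⟩ʳ s ∈ B i π

{-# OPTIONS --safe #-}

module Submission where

-- Call a street an m-snapshot of π when it holds the cars below m, each in its
-- place in π, and nothing else.  On the i-snapshot, a spot k other than that of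
-- i is available for i exactly when π_k is not a blocker for i, while the spot
-- of i is available because π is a Hamiltonian path.  So, starting from the
-- i-snapshot, car i parks in its place in π iff the block from p_i to i consists
-- of blockers.  Since cars never leave, an (i + 1)-snapshot can only arise from
-- an i-snapshot, and the theorem follows by induction on the number of cars.

open import Defs
open import Data.Nat.Base using (ℕ)
open import Data.Fin.Permutation using (Permutation′)
open import Function.Bundles using (_⇔_)
open import Relation.Unary using (_∈_)

open import Data.Nat.Base as ℕ using (zero; suc)
import Data.Nat.Properties as ℕ
open import Data.Fin.Base using (Fin; zero; suc; toℕ; fromℕ<; _≤_; _<_)
open import Data.Fin.Properties
  using (_≟_; _≤?_; _<?_; all?; any?; toℕ<n; toℕ-fromℕ<; toℕ-injective)
open import Data.Fin.Permutation using (_⟨$⟩ʳ_; _⟨$⟩ˡ_; inverseˡ; inverseʳ)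
open import Data.List.Base using (find; tabulate)
open import Data.Maybe.Base using (just; nothing)
open import Data.Maybe.Properties using (just-injective)
open import Data.Maybe.Relation.Unary.All using (All; just; nothing)
open import Data.Maybe.Relation.Unary.Any using (just)
open import Data.Product.Base using (_×_; _,_; proj₁; ∃-syntax)
open import Data.Sum.Base using (_⊎_; inj₁; inj₂)
open import Data.Vec.Functional using (updateAt)
open import Data.Vec.Functional.Properties using (updateAt-updates; updateAt-minimal)
open import Function.Base using (const; id; _∘_)
open import Function.Bundles using (mk⇔; Equivalence)
open import Level using (Level; 0ℓ)
open import Relation.Binary.PropositionalEquality
  using (_≡_; _≢_; _≗_; refl; sym; trans; cong; subst; module ≡-Reasoning)
open import Relation.Nullary
  using (¬_; yes; no; contradiction; ¬?; _×-dec_; _⊎-dec_; _→-dec_)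
open import Relation.Unary using (Pred; Decidable)

private
  variable
    a ℓ : Level
    A : Set a
    n : ℕ

-- Least witnesses and linear search.

First : Pred (Fin n) ℓ → Pred (Fin n) ℓ
First P k = P k × (∀ j → j < k → ¬ P j)

first-exists : {P : Pred (Fin n) ℓ} → Decidable P → ∀ k → P k → ∃[ f ] First P f
first-exists {n = suc _} P? k Pk with P? zero
first-exists {n = suc _} P? k       Pk | yes P0 = zero , P0 , λ _ ()
first-exists {n = suc _} P? zero    Pk | no ¬P0 = contradiction Pk ¬P0
first-exists {n = suc _} P? (suc k) Pk | no ¬P0 with first-exists (P? ∘ suc) k Pk
... | f , Pf , below =
  suc f , Pf , λ { zero _ → ¬P0 ; (suc j) j<f → below j (ℕ.s<s⁻¹ j<f) }

-- The tail of `tabulate f` is `tabulate (f ∘ suc)`, so the induction needs an arbitrary `f`;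
-- `allFin n` is the case `f = id`.
find-tabulate⁻ : {P : Pred A ℓ} (P? : Decidable P) (f : Fin n → A) {x : A} →
  find P? (tabulate f) ≡ just x → ∃[ k ] f k ≡ x × First (P ∘ f) k
find-tabulate⁻ {n = suc n} P? f eq with P? (f zero)
... | yes P0 = zero , just-injective eq , P0 , λ _ ()
... | no ¬P0 with find-tabulate⁻ P? (f ∘ suc) eq
... | k , fk≡x , Pk , below =
  suc k , fk≡x , Pk , λ { zero _ → ¬P0 ; (suc j) j<k → below j (ℕ.s<s⁻¹ j<k) }

find-tabulate⁺ : {P : Pred A ℓ} (P? : Decidable P) (f : Fin n → A) {k : Fin n} →
  First (P ∘ f) k → find P? (tabulate f) ≡ just (f k)
find-tabulate⁺ {n = suc _} P? f {k} (Pk , below) with P? (f zero)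
find-tabulate⁺ {n = suc _} P? f {zero}  (Pk , below) | yes P0 = refl
find-tabulate⁺ {n = suc _} P? f {suc k} (Pk , below) | yes P0 = contradiction P0 (below zero ℕ.z<s)
find-tabulate⁺ {n = suc _} P? f {zero}  (Pk , below) | no ¬P0 = contradiction Pk ¬P0
find-tabulate⁺ {n = suc _} P? f {suc k} (Pk , below) | no ¬P0 =
  find-tabulate⁺ P? (f ∘ suc) (Pk , λ j j<k → below (suc j) (ℕ.s<s j<k))

module _ (G : Graph n) where

  module _ (π : Permutation′ n) where

    -- Blocking sequences.

    blocker? : ∀ i → Decidable (Blocker G i π)
    blocker? i j =
      (j ≤? i) ⊎-dec
      (i <? j ×-dec
       any? (λ l → neighbouring? (π ⟨$⟩ˡ j) (π ⟨$⟩ˡ l) ×-dec l <? i ×-dec ¬? (adj? G l i)))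

    blockFrom? : ∀ i → Decidable (BlockFrom G i π)
    blockFrom? i s =
      (s ≤? π ⟨$⟩ˡ i) ×-dec
      all? (λ r → (s ≤? r) →-dec ((r ≤? π ⟨$⟩ˡ i) →-dec blocker? i (π ⟨$⟩ʳ r)))

    -- A final segment of a block of blockers is again such a block.
    S⇒BlockFrom : ∀ {i s} → s ∈ S G i π → BlockFrom G i π s
    S⇒BlockFrom {i} {s} (f , ((_ , blockers) , _) , f≤s , s≤i)
      rewrite inverseˡ π {s} =
      s≤i , λ r s≤r → blockers r (ℕ.≤-trans f≤s s≤r)

    -- All blocks end at `i`, so the longest is the one with the least start, which exists because
    -- `BlockFrom` is decidable.
    BlockFrom⇒S : ∀ {i s} → BlockFrom G i π s → s ∈ S G i π
    BlockFrom⇒S {i} {s} block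
      with f , blockf , below ← first-exists (blockFrom? i) s block
      rewrite inverseˡ π {s} =
      f , (blockf , longest) , least block , proj₁ block
      where
      least : ∀ {s′} → BlockFrom G i π s′ → f ≤ s′
      least block′ = ℕ.≮⇒≥ λ s′<f → below _ s′<f block′

      longest : ∀ s′ → BlockFrom G i π s′ →
                blockLength G i π s′ ℕ.≤ blockLength G i π f
      longest s′ block′ = ℕ.s≤s (ℕ.∸-monoʳ-≤ (toℕ (π ⟨$⟩ˡ i)) (least block′))

    -- Snapshots and how one car changes them.

    Snapshot : ℕ → Street n → Set
    Snapshot m σ = ∀ k →
      (toℕ (π ⟨$⟩ʳ k) ℕ.< m × σ k ≡ just (π ⟨$⟩ʳ k)) ⊎
      (m ℕ.≤ toℕ (π ⟨$⟩ʳ k) × σ k ≡ nothing)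

    snapshot-full : ∀ {σ} → Snapshot n σ ⇔ (σ ≗ just ∘ (π ⟨$⟩ʳ_))
    snapshot-full {σ} = mk⇔ to (λ σ≗π k → inj₁ (toℕ<n _ , σ≗π k))
      where
      to : Snapshot n σ → σ ≗ just ∘ (π ⟨$⟩ʳ_)
      to snap k with snap k
      ... | inj₁ (_ , σk≡) = σk≡
      ... | inj₂ (n≤ , _)  = contradiction (toℕ<n _) (ℕ.≤⇒≯ n≤)

    snapshot-add : ∀ {i σ} → Snapshot (toℕ i) σ →
      Snapshot (suc (toℕ i)) (updateAt σ (π ⟨$⟩ˡ i) (const (just i)))
    snapshot-add {i} {σ} snap k with k ≟ π ⟨$⟩ˡ i
    ... | yes refl rewrite inverseʳ π {i} =
      inj₁ (ℕ.≤-refl , updateAt-updates (π ⟨$⟩ˡ i) σ)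
    ... | no k≢ with snap k
    ... | inj₁ (πk<i , σk≡) =
      inj₁ (ℕ.m<n⇒m<1+n πk<i , trans (updateAt-minimal k (π ⟨$⟩ˡ i) σ k≢) σk≡)
    ... | inj₂ (i≤πk , σk≡) =
      inj₂ (ℕ.≤∧≢⇒< i≤πk i≢πk , trans (updateAt-minimal k (π ⟨$⟩ˡ i) σ k≢) σk≡)
      where
      i≢πk : toℕ i ≢ toℕ (π ⟨$⟩ʳ k)
      i≢πk eq = k≢ (trans (sym (inverseˡ π)) (cong (π ⟨$⟩ˡ_) (sym (toℕ-injective eq))))

    snapshot-place : ∀ {m i σ k} → Snapshot m (updateAt σ k (const (just i))) →
      π ⟨$⟩ʳ k ≡ i
    snapshot-place {σ = σ} {k} snap with snap k
    ... | inj₁ (_ , eq) = sym (just-injective (trans (sym (updateAt-updates k σ)) eq))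
    ... | inj₂ (_ , eq) with () ← trans (sym (updateAt-updates k σ)) eq

    -- The update forgets what spot `k` held before, so its emptiness has to be assumed; all other
    -- spots are unchanged.
    snapshot-remove : ∀ {i σ k} → σ k ≡ nothing →
      Snapshot (suc (toℕ i)) (updateAt σ k (const (just i))) → Snapshot (toℕ i) σ
    snapshot-remove {i} {σ} {k} σk≡ snap l with l ≟ k
    ... | yes refl =
      inj₂ (ℕ.≤-reflexive (cong toℕ (sym (snapshot-place {σ = σ} snap))) , σk≡)
    ... | no l≢k with snap l
    ... | inj₂ (i<πl , eq) = inj₂ (ℕ.<⇒≤ i<πl , trans (sym (updateAt-minimal l k σ l≢k)) eq)
    ... | inj₁ (πl≤i , eq) =
      inj₁ (ℕ.≤∧≢⇒< (ℕ.s≤s⁻¹ πl≤i) πl≢i , trans (sym (updateAt-minimal l k σ l≢k)) eq)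
      where
      open ≡-Reasoning
      -- Car `i` has its place in π at `k`, and `l` is a different spot.
      πl≢i : toℕ (π ⟨$⟩ʳ l) ≢ toℕ i
      πl≢i πl≡i = l≢k (begin
        l                      ≡⟨ inverseˡ π ⟨
        π ⟨$⟩ˡ (π ⟨$⟩ʳ l)      ≡⟨ cong (π ⟨$⟩ˡ_) (toℕ-injective πl≡i) ⟩
        π ⟨$⟩ˡ i               ≡⟨ cong (π ⟨$⟩ˡ_) (snapshot-place {σ = σ} snap) ⟨
        π ⟨$⟩ˡ (π ⟨$⟩ʳ k)      ≡⟨ inverseˡ π ⟩
        k                      ∎)

    -- Availability on a snapshot versus blockers.

    own-spot-available : π ∈ Ham G → ∀ {i σ} → Snapshot (toℕ i) σ →
      Available G σ i (π ⟨$⟩ˡ i)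
    own-spot-available ham {i} {σ} snap = empty , friends
      where
      empty : σ (π ⟨$⟩ˡ i) ≡ nothing
      empty with snap (π ⟨$⟩ˡ i)
      ... | inj₁ (πk<i , _) = contradiction (cong toℕ (inverseʳ π)) (ℕ.<⇒≢ πk<i)
      ... | inj₂ (_ , eq)   = eq

      adjacent : ∀ l → Neighbouring (π ⟨$⟩ˡ i) l → Adj G i (π ⟨$⟩ʳ l)
      adjacent l (inj₁ k≡1+l) =
        subst (λ j → Adj G j _) (inverseʳ π) (Graph.sym G (ham l (π ⟨$⟩ˡ i) k≡1+l))
      adjacent l (inj₂ l≡1+k) =
        subst (λ j → Adj G j _) (inverseʳ π) (ham (π ⟨$⟩ˡ i) l l≡1+k)

      friends : ∀ l → Neighbouring (π ⟨$⟩ˡ i) l → All (Adj G i) (σ l)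
      friends l nb with snap l
      ... | inj₁ (_ , eq) = subst (All _) (sym eq) (just (adjacent l nb))
      ... | inj₂ (_ , eq) = subst (All _) (sym eq) nothing

    available-blocker⇒own-spot : ∀ {i σ k} → Snapshot (toℕ i) σ →
      Available G σ i k → Blocker G i π (π ⟨$⟩ʳ k) → k ≡ π ⟨$⟩ˡ i
    available-blocker⇒own-spot {k = k} snap (σk≡ , _) (inj₁ πk≤i) with snap k
    ... | inj₁ (_ , eq) with () ← trans (sym σk≡) eq
    ... | inj₂ (i≤πk , _) =
      trans (sym (inverseˡ π)) (cong (π ⟨$⟩ˡ_) (toℕ-injective (ℕ.≤-antisym πk≤i i≤πk)))
    available-blocker⇒own-spot {i} {k = k} snap (_ , friends)
      (inj₂ (_ , l , nb , l<i , ¬adj))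
      with friends (π ⟨$⟩ˡ l) (subst (λ r → Neighbouring r _) (inverseˡ π) nb)
         | snap (π ⟨$⟩ˡ l)
    ... | _ | inj₂ (i≤ , _) =
      contradiction l<i (ℕ.≤⇒≯ (subst (λ j → i ≤ j) (inverseʳ π) i≤))
    ... | all | inj₁ (_ , eq) with just adj ← subst (All _) eq all =
      contradiction (Graph.sym G (subst (Adj G i) (inverseʳ π) adj)) ¬adj

    -- By contraposition: if π_k is not a blocker, it exceeds `i`, so spot `k` is still empty, and
    -- every car already parked beside it is a friend of `i`.
    unavailable⇒blocker : ∀ {i σ k} → Snapshot (toℕ i) σ →
      ¬ Available G σ i k → Blocker G i π (π ⟨$⟩ʳ k)
    unavailable⇒blocker {i} {σ} {k} snap unavailable with blocker? i (π ⟨$⟩ʳ k)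
    ... | yes blocker = blocker
    ... | no ¬blocker = contradiction (empty , friends) unavailable
      where
      i<πk : i < π ⟨$⟩ʳ k
      i<πk = ℕ.≰⇒> (¬blocker ∘ inj₁)

      empty : σ k ≡ nothing
      empty with snap k
      ... | inj₁ (πk<i , _) = contradiction (inj₁ (ℕ.<⇒≤ πk<i)) ¬blocker
      ... | inj₂ (_ , eq)   = eq

      friends : ∀ l → Neighbouring k l → All (Adj G i) (σ l)
      friends l nb with snap l
      ... | inj₂ (_ , eq) = subst (All _) (sym eq) nothing
      ... | inj₁ (πl<i , eq) with adj? G (π ⟨$⟩ʳ l) i
      ... | yes adj = subst (All _) (sym eq) (just (Graph.sym G adj))
      ... | no ¬adj = contradiction (inj₂ (i<πk , π ⟨$⟩ʳ l , nb′ , πl<i , ¬adj)) ¬blocker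
        where
        nb′ : Neighbouring (π ⟨$⟩ˡ (π ⟨$⟩ʳ k)) (π ⟨$⟩ˡ (π ⟨$⟩ʳ l))
        nb′ rewrite inverseˡ π {k} | inverseˡ π {l} = nb

  module _ (p : Preference n) where

    -- Parking a single car.

    Candidate : Street n → Fin n → Pred (Fin n) 0ℓ
    Candidate σ i k = p i ≤ k × Available G σ i k

    candidate? : ∀ σ i → Decidable (Candidate σ i)
    candidate? σ i k = (p i ≤? k) ×-dec available? G σ i k

    FirstFit : Street n → Fin n → Pred (Fin n) 0ℓ
    FirstFit σ i = First (Candidate σ i)

    park⁻ : ∀ {i σ σ′} → park G p i σ ≡ just σ′ →
      ∃[ k ] FirstFit σ i k × σ′ ≡ updateAt σ k (const (just i))
    park⁻ {i} {σ} eq with firstAvailable G σ i (p i) in found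
    park⁻ {i} {σ} refl | just k
      with _ , refl , first ← find-tabulate⁻ (candidate? σ i) id found =
      k , first , refl

    park⁺ : ∀ {i σ k} → FirstFit σ i k →
      park G p i σ ≡ just (updateAt σ k (const (just i)))
    park⁺ {i} {σ} first
      rewrite find-tabulate⁺ (candidate? σ i) id first =
      refl

    module _ (π : Permutation′ n) (ham : π ∈ Ham G) where

      firstFit⇒block : ∀ {i σ} → Snapshot π (toℕ i) σ →
        FirstFit σ i (π ⟨$⟩ˡ i) → BlockFrom G i π (p i)
      firstFit⇒block {i} {σ} snap ((pi≤ , _) , below) = pi≤ , blockers
        where
        blockers : ∀ r → p i ≤ r → r ≤ π ⟨$⟩ˡ i → Blocker G i π (π ⟨$⟩ʳ r)
        blockers r pi≤r r≤ with r ≟ π ⟨$⟩ˡ i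
        -- The block ends with `i`, which is a blocker for itself.
        ... | yes refl = inj₁ (ℕ.≤-reflexive (cong toℕ (inverseʳ π)))
        ... | no r≢ = unavailable⇒blocker π snap λ available →
          below r (ℕ.≤∧≢⇒< r≤ (r≢ ∘ toℕ-injective)) (pi≤r , available)

      block⇒firstFit : ∀ {i σ} → Snapshot π (toℕ i) σ →
        BlockFrom G i π (p i) → FirstFit σ i (π ⟨$⟩ˡ i)
      block⇒firstFit snap (pi≤ , blockers) =
        (pi≤ , own-spot-available π ham snap) ,
        λ j j< (pi≤j , available) → ℕ.<⇒≢ j< (cong toℕ
          (available-blocker⇒own-spot π snap available (blockers j pi≤j (ℕ.<⇒≤ j<))))

      -- Nothing is assumed about the street before: the later snapshot dictates both where `i`
      -- parked and what was there already.
      park-snapshot⁻ : ∀ {i σ σ′} → park G p i σ ≡ just σ′ →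
        Snapshot π (suc (toℕ i)) σ′ → Snapshot π (toℕ i) σ × BlockFrom G i π (p i)
      park-snapshot⁻ {i} {σ} parks snap′
        with k , first@((_ , σk≡ , _) , _) , refl ← park⁻ parks =
        snap , firstFit⇒block snap (subst (FirstFit σ i) k≡ first)
        where
        snap = snapshot-remove π σk≡ snap′
        k≡ : k ≡ π ⟨$⟩ˡ i
        k≡ = trans (sym (inverseˡ π)) (cong (π ⟨$⟩ˡ_) (snapshot-place π {σ = σ} snap′))

      -- Induction on the number of cars.

      Reaches : ∀ m → m ℕ.≤ n → Set
      Reaches m m≤n = ∃[ σ ] parkFirst G p m m≤n ≡ just σ × Snapshot π m σ

      reaches⁻ : ∀ {m} (m≤n : m ℕ.≤ n) → Reaches m m≤n →
        ∀ i → toℕ i ℕ.< m → BlockFrom G i π (p i)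
      reaches⁻ {suc m} m<n (σ′ , parks , snap′) i i<1+m
        with parkFirst G p m (ℕ.<⇒≤ m<n) in earlier
      -- Had one of the first `m` cars failed, `parks` would equate `nothing` with a `just`.
      ... | just σ
        -- The number of the car `fromℕ< m<n` equals `m` only propositionally, hence the transports.
        with snap , block ← park-snapshot⁻ parks
               (subst (λ l → Snapshot π (suc l) σ′) (sym (toℕ-fromℕ< m<n)) snap′)
        with ℕ.m<1+n⇒m<n∨m≡n i<1+m
      ... | inj₁ i<m = reaches⁻ (ℕ.<⇒≤ m<n)
        (σ , earlier , subst (λ l → Snapshot π l σ) (toℕ-fromℕ< m<n) snap) i i<m
      ... | inj₂ i≡m = subst (λ j → BlockFrom G j π (p j))
        (toℕ-injective (trans (toℕ-fromℕ< m<n) (sym i≡m))) block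

      -- The empty street is the 0-snapshot, and each block condition sends the next car to its
      -- place in π.
      reaches⁺ : (∀ i → BlockFrom G i π (p i)) → ∀ m (m≤n : m ℕ.≤ n) → Reaches m m≤n
      reaches⁺ blocks zero    _   = _ , refl , λ _ → inj₂ (ℕ.z≤n , refl)
      reaches⁺ blocks (suc m) m<n
        with σ , earlier , snap ← reaches⁺ blocks m (ℕ.<⇒≤ m<n)
        rewrite earlier =
        _ , park⁺ (block⇒firstFit snap′ (blocks i)) ,
        subst (λ l → Snapshot π (suc l) σ′) (toℕ-fromℕ< m<n) (snapshot-add π snap′)
        where
        i = fromℕ< m<n
        σ′ = updateAt σ (π ⟨$⟩ˡ i) (const (just i))
        snap′ = subst (λ l → Snapshot π l σ) (sym (toℕ-fromℕ< m<n)) snap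

      outcome⇔reaches : HasOutcome G p π ⇔ Reaches n ℕ.≤-refl
      outcome⇔reaches = mk⇔ to from
        where
        open module Full {σ} = Equivalence (snapshot-full π {σ})
          using () renaming (to to full⁻; from to full⁺)

        to : HasOutcome G p π → Reaches n ℕ.≤-refl
        -- Once `parkFirst` is known to be `just σ`, `finalStreet` computes to `σ`.
        to (fpf , final) with parkFirst G p n ℕ.≤-refl
        to (just _ , final) | just σ = σ , refl , full⁺ final

        from : Reaches n ℕ.≤-refl → HasOutcome G p π
        from (σ , eq , snap) rewrite eq = just _ , full⁻ snap

theorem2p6 : (n : ℕ) (G : Graph n) (π : Permutation′ n) → π ∈ Ham G →
    (p : Preference n) →
    HasOutcome G p π ⇔ (∀ i → p i ∈ S G i π)
theorem2p6 n G π ham p = mk⇔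
  (λ outcome i → BlockFrom⇒S G π
    (reaches⁻ G p π ham ℕ.≤-refl (to outcome) i (toℕ<n i)))
  (λ p∈S → from (reaches⁺ G p π ham (S⇒BlockFrom G π ∘ p∈S) n ℕ.≤-refl))
  where open Equivalence (outcome⇔reaches G p π ham)
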